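{- Let $\exists X[F]$ be an $\exists$CNF formula. Suppose the D-sequents $(\exists X[F],q',W')\rightarrow Z$ and $(\exists X[F],q'',W'')\rightarrow Z$ hold and $\mathrm{Vars}(q')\cap W''=\mathrm{Vars}(q'')\cap W'=\emptyset$. Let $q'$ and $q''$ be resolvable on a variable $v\in\mathrm{Vars}(F)$ and let $q$ be the resolvent of $q'$ and $q''$ on $v$. Then the D-sequent $(\exists X[F],q,W'\cup W'')\rightarrow Z$ holds too.
   Context: A clause is a disjunction of literals of Boolean variables; a CNF formula $F$ is a (finite) set of clauses, understood as their conjunction. $\mathrm{Vars}(\cdot)$ denotes the set of variables of a clause, formula or assignment. Assignments may be partial and are treated as sets of single-variable value assignments. An $\exists$CNF formula is $\exists X[F]$ with $X\subseteq\mathrm{Vars}(F)$; $\equiv$ means equality of truth values under every complete assignment to the free (non-$X$) variables. For an assignment $q$, $F_q$ is obtained from $F$ by removing all clauses satisfied by $q$ and deleting from the remaining clauses all literals falsified by $q$. Redundancy: $F^Z$ is the set of clauses of $F$ containing a variable of $Z$. The variables of $Z$ are redundant in $\exists X[F]$ if $\exists X[F]\equiv\exists X[F\setminus F^Z]$ (also used with $F_q$ in place of $F$, where $X$ need not be contained in $\mathrm{Vars}(F_q)$). Boundary points: a point of $F$ is an assignment $p$ with $\mathrm{Vars}(F)\subseteq\mathrm{Vars}(p)$. It is a $V$-boundary point of $F$ if $V\neq\emptyset$, $p$ falsifies $F$, every clause of $F$ falsified by $p$ contains a variable of $V$, and the last condition fails for every proper subset of $V$. Scoped redundancy: for $Z\subseteq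 X$ and $W\supseteq Z$, the variables of $Z$ are redundant in $\exists X[F]$ with scope $W$ if they are redundant in $\exists X[F]$ and, for every non-empty $V\subseteq Z$, every $V$-boundary point of $F$ can be turned into an assignment satisfying $F$ by changing only values of variables of $W$. D-sequents: let $q$ be an assignment to variables of $F$ and $Z\subseteq W\subseteq X\setminus\mathrm{Vars}(q)$. The D-sequent $(\exists X[F],q,W)\rightarrow Z$ states (holds iff) the variables of $Z$ are redundant in $\exists X[F_q]$ with scope $W$. Assignments $q',q''$ are resolvable on $v$ if $v$ is the only variable of $\mathrm{Vars}(q')\cap\mathrm{Vars}(q'')$ assigned different values in $q'$ and $q''$; their resolvent on $v$ is the assignment consisting of all assignments of $q'$ and $q''$ except those to $v$. -}

module Defs where

open import Data.Bool.Base using (Bool; not)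
import Data.Bool.Properties as Bool
open import Data.Fin.Base using (Fin)
import Data.Fin.Properties as Fin
open import Data.Fin.Subset
  using (Subset; _∈_; _∉_; _⊆_; _⊂_; _∩_; _∪_; _─_; ⋃; ⁅_⁆; Nonempty)
open import Data.Fin.Subset.Properties using (nonempty?)
open import Data.List.Base using (List; map; filter)
import Data.List.Membership.Propositional as List
open import Data.List.Relation.Unary.All using (All)
open import Data.List.Relation.Unary.Any using (Any; any?)
open import Data.Maybe.Base using (Maybe; just; nothing; is-just; _<∣>_)
import Data.Maybe.Properties as Maybe
open import Data.Nat.Base using (ℕ)
open import Data.Product.Base using (_×_; _,_; proj₁; ∃-syntax)
open import Data.Vec.Base using (tabulate)
open import Function.Base using (_∘_)
open import Function.Bundles using (_⇔_)
open import Relation.Binary.PropositionalEquality using (_≡_; _≢_)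
open import Relation.Nullary using (¬_; Dec; yes; no; ¬?)

private
  variable
    n : ℕ

-- Boolean variables are drawn from an arbitrary finite pool Fin n.  The pool
-- may be larger than the set of variables of any formula under consideration.

-- The literal (x , true) is x, and (x , false) is its negation.
Literal : ℕ → Set
Literal n = Fin n × Bool

-- Lists stand for finite sets: order and repetitions play no role in any of
-- the definitions below.
Clause : ℕ → Set
Clause n = List (Literal n)

CNF : ℕ → Set
CNF n = List (Clause n)

-- Partial assignments.
Assignment : ℕ → Set
Assignment n = Fin n → Maybe Bool

varsᶜ : Clause n → Subset n
varsᶜ C = ⋃ (map (⁅_⁆ ∘ proj₁) C)

varsᶠ : CNF n → Subset n
varsᶠ F = ⋃ (map varsᶜ F)

varsᵃ : Assignment n → Subset n
varsᵃ q = tabulate (is-just ∘ q)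

Satisfiesˡ Falsifiesˡ : Assignment n → Literal n → Set
Satisfiesˡ q (x , b) = q x ≡ just b
Falsifiesˡ q (x , b) = q x ≡ just (not b)

Satisfiesᶜ Falsifiesᶜ : Assignment n → Clause n → Set
Satisfiesᶜ q C = Any (Satisfiesˡ q) C
Falsifiesᶜ q C = All (Falsifiesˡ q) C

Satisfies Falsifies : Assignment n → CNF n → Set
Satisfies q F = All (Satisfiesᶜ q) F
Falsifies q F = Any (Falsifiesᶜ q) F

satisfiesˡ? : (q : Assignment n) (l : Literal n) → Dec (Satisfiesˡ q l)
satisfiesˡ? q (x , b) = Maybe.≡-dec Bool._≟_ (q x) (just b)

falsifiesˡ? : (q : Assignment n) (l : Literal n) → Dec (Falsifiesˡ q l)
falsifiesˡ? q (x , b) = Maybe.≡-dec Bool._≟_ (q x) (just (not b))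

satisfiesᶜ? : (q : Assignment n) (C : Clause n) → Dec (Satisfiesᶜ q C)
satisfiesᶜ? q = any? (satisfiesˡ? q)

-- F_q
infixl 8 _∣ᵣ_

_∣ᵣ_ : CNF n → Assignment n → CNF n
F ∣ᵣ q = map (filter (¬? ∘ falsifiesˡ? q)) (filter (¬? ∘ satisfiesᶜ? q) F)

ContainsVarOf : Subset n → Clause n → Set
ContainsVarOf Z C = Nonempty (varsᶜ C ∩ Z)

containsVarOf? : (Z : Subset n) (C : Clause n) → Dec (ContainsVarOf Z C)
containsVarOf? Z C = nonempty? (varsᶜ C ∩ Z)

-- F ∖ F^Z
infixl 7 _∖^_

_∖^_ : CNF n → Subset n → CNF n
F ∖^ Z = filter (¬? ∘ containsVarOf? Z) F

-- ∃X[F] is true when the non-X variables take their values from s; values that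
-- s may assign to variables of X are ignored.
True∃ : Subset n → CNF n → Assignment n → Set
True∃ X F s =
  ∃[ p ] X ⊆ varsᵃ p × (∀ {x} → x ∉ X → p x ≡ s x) × Satisfies p F

-- ∃X[F] ≡ ∃X[G]
Equivalent∃ : Subset n → CNF n → CNF n → Set
Equivalent∃ X F G =
  ∀ s → (varsᶠ F ∪ varsᶠ G) ─ X ⊆ varsᵃ s → True∃ X F s ⇔ True∃ X G s

Redundant : Subset n → CNF n → Subset n → Set
Redundant X F Z = Equivalent∃ X F (F ∖^ Z)

IsPoint : CNF n → Assignment n → Set
IsPoint F p = varsᶠ F ⊆ varsᵃ p

FalsifiedContain : CNF n → Assignment n → Subset n → Set
FalsifiedContain F p V =
  ∀ {C} → C List.∈ F → Falsifiesᶜ p C → ContainsVarOf V C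

record IsBoundaryPoint (F : CNF n) (V : Subset n) (p : Assignment n) : Set where
  field
    point     : IsPoint F p
    nonempty  : Nonempty V
    falsifies : Falsifies p F
    contain   : FalsifiedContain F p V
    minimal   : ∀ {V′} → V′ ⊂ V → ¬ FalsifiedContain F p V′

-- Values may be changed, but the set of assigned variables stays the same.
SatisfiableByChanging : Subset n → CNF n → Assignment n → Set
SatisfiableByChanging W F p =
  ∃[ p* ] varsᵃ p* ≡ varsᵃ p × (∀ {x} → x ∉ W → p* x ≡ p x) × Satisfies p* F

record RedundantWithScope (X : Subset n) (F : CNF n) (W Z : Subset n) : Set where
  field
    redundant : Redundant X F Z
    scope     : ∀ {V} → Nonempty V → V ⊆ Z →
                ∀ p → IsBoundaryPoint F V p → SatisfiableByChanging W F p

-- The D-sequent (∃X[F], q, W) → Z is well formed and holds.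
record DSequent (X : Subset n) (F : CNF n) (q : Assignment n)
                (W Z : Subset n) : Set where
  field
    vars-q : varsᵃ q ⊆ varsᶠ F
    Z⊆W    : Z ⊆ W
    W⊆X─q  : W ⊆ X ─ varsᵃ q
    holds  : RedundantWithScope X (F ∣ᵣ q) W Z

Conflict : Assignment n → Assignment n → Fin n → Set
Conflict q′ q″ x = x ∈ varsᵃ q′ ∩ varsᵃ q″ × q′ x ≢ q″ x

Resolvable : Assignment n → Assignment n → Fin n → Set
Resolvable q′ q″ v = Conflict q′ q″ v × (∀ {x} → Conflict q′ q″ x → x ≡ v)

-- For assignments resolvable on v the left bias of _<∣>_ is immaterial: they
-- agree on all other common variables.
resolvent : Fin n → Assignment n → Assignment n → Assignment n
resolvent v q′ q″ x with x Fin.≟ v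
... | yes _ = nothing
... | no  _ = q′ x <∣> q″ x

{-# OPTIONS --safe #-}
module Submission where

-- Scoped redundancy of Z in ∃X[G] with W ⊆ X amounts to: every point of G all of
-- whose falsified clauses meet Z can be repaired by changing W only (pass to a
-- minimal V ⊆ Z to get a boundary point).  Given such a point p of F_q, overwrite
-- it by q and complete it to a total assignment t.  The value t v agrees with q′
-- or with q″, so t extends one of them, say q′.  As W′ avoids Vars(q′) and
-- Vars(q″), the repair of t for F_q′ still extends q and q′, hence satisfies F
-- and then F_q.  Transporting its values on Vars(F_q) back to p repairs p.

open import Defs
open import Data.Bool.Base using (Bool; true; not)
import Data.Bool.Properties as Bool
open import Data.Nat.Base using (ℕ)
open import Data.Fin.Base using (Fin)
import Data.Fin.Properties as Fin
open import Data.Fin.Subset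
  using (Subset; _∈_; _∉_; _⊆_; _⊂_; _∩_; _∪_; _─_; ⋃; ⁅_⁆; Empty; inside)
open import Data.Fin.Subset.Induction using (⊂-wellFounded)
open import Data.Fin.Subset.Properties
open import Data.List.Base using ([]; _∷_; filter)
import Data.List.Membership.Propositional as List
open import Data.List.Membership.Propositional.Properties
open import Data.List.Relation.Unary.All as All using (All; all?)
open import Data.List.Relation.Unary.Any using (here; there; any?)
open import Data.Maybe.Base using (just; nothing; is-just; fromMaybe; _<∣>_)
open import Data.Maybe.Properties using (just-injective)
open import Data.Product.Base using (_×_; _,_; proj₁; proj₂; ∃-syntax)
open import Data.Sum.Base using (_⊎_; inj₁; inj₂; [_,_]′)
open import Data.Vec.Base using (_∷_; here; there)
open import Data.Vec.Properties using (lookup∘tabulate; []=⇒lookup; lookup⇒[]=)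
open import Function.Base using (_∘_; id)
open import Function.Bundles using (mk⇔)
open import Induction.WellFounded using (Acc; acc)
open import Relation.Binary.PropositionalEquality
open import Relation.Nullary using (¬_; yes; no; ¬?; contradiction)
open import Relation.Nullary.Decidable using (map′; _×-dec_; _→-dec_)
open import Relation.Unary using (Pred; Decidable)

private
  variable
    n : ℕ

-- Minimal sets with a decidable property.

minimal-subset : ∀ {ℓ} {P : Pred (Subset n) ℓ} → Decidable P → ∀ {V} → P V →
                 ∃[ U ] U ⊆ V × P U × (∀ {U′} → U′ ⊂ U → ¬ P U′)
minimal-subset {P = P} P? {V} = go (⊂-wellFounded V)
  where
  go : ∀ {V} → Acc _⊂_ V → P V →
       ∃[ U ] U ⊆ V × P U × (∀ {U′} → U′ ⊂ U → ¬ P U′)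
  -- A finite search decides whether some proper subset still has `P`; if so, the descent continues
  -- there, and otherwise `V` is minimal.
  go {V} (acc smaller) PV with anySubset? (λ U → (U ⊂? V) ×-dec P? U)
  ... | no  none = V , id , PV , λ U⊂V PU → none (_ , U⊂V , PU)
  ... | yes (U , U⊂V , PU) =
    let U₀ , U₀⊆U , rest = go (smaller U⊂V) PU
    in  U₀ , proj₁ U⊂V ∘ U₀⊆U , rest

-- Membership in sets of variables.

∈-⋃⁺ : ∀ {x : Fin n} {p ps} → x ∈ p → p List.∈ ps → x ∈ ⋃ ps
∈-⋃⁺ x∈p (here refl)  = x∈p∪q⁺ (inj₁ x∈p)
∈-⋃⁺ x∈p (there p∈ps) = x∈p∪q⁺ (inj₂ (∈-⋃⁺ x∈p p∈ps))

∈-⋃⁻ : ∀ {x : Fin n} ps → x ∈ ⋃ ps → ∃[ p ] p List.∈ ps × x ∈ p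
∈-⋃⁻ []       x∈⊥ = contradiction x∈⊥ ∉⊥
∈-⋃⁻ (p ∷ ps) x∈  with x∈p∪q⁻ p (⋃ ps) x∈
... | inj₁ x∈p = p , here refl , x∈p
... | inj₂ x∈⋃ = let r , r∈ps , x∈r = ∈-⋃⁻ ps x∈⋃ in r , there r∈ps , x∈r

∈-varsᶜ⁺ : ∀ {x : Fin n} {b C} → (x , b) List.∈ C → x ∈ varsᶜ C
∈-varsᶜ⁺ l∈C = ∈-⋃⁺ (x∈⁅x⁆ _) (∈-map⁺ (⁅_⁆ ∘ proj₁) l∈C)

∈-varsᶜ⁻ : ∀ {x : Fin n} C → x ∈ varsᶜ C → ∃[ b ] (x , b) List.∈ C
∈-varsᶜ⁻ C x∈ with ∈-⋃⁻ _ x∈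
... | _ , p∈ , x∈p with ∈-map⁻ (⁅_⁆ ∘ proj₁) p∈
... | (y , b) , l∈C , refl with refl ← x∈⁅y⁆⇒x≡y y x∈p = b , l∈C

∈-varsᶠ⁺ : ∀ {x : Fin n} {C F} → C List.∈ F → x ∈ varsᶜ C → x ∈ varsᶠ F
∈-varsᶠ⁺ C∈F x∈C = ∈-⋃⁺ x∈C (∈-map⁺ varsᶜ C∈F)

∈-varsᶠ⁻ : ∀ {x : Fin n} F → x ∈ varsᶠ F → ∃[ C ] C List.∈ F × x ∈ varsᶜ C
∈-varsᶠ⁻ F x∈ with ∈-⋃⁻ _ x∈
... | _ , p∈ , x∈p with ∈-map⁻ varsᶜ p∈
... | C , C∈F , refl = C , C∈F , x∈p

∈-varsᵃ⁺ : ∀ (q : Assignment n) {x b} → q x ≡ just b → x ∈ varsᵃ q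
∈-varsᵃ⁺ q {x} eq =
  lookup⇒[]= x _ (trans (lookup∘tabulate (is-just ∘ q) x) (cong is-just eq))

∈-varsᵃ⁻ : ∀ (q : Assignment n) {x} → x ∈ varsᵃ q → ∃[ b ] q x ≡ just b
∈-varsᵃ⁻ q {x} x∈
  with q x | trans (sym (lookup∘tabulate (is-just ∘ q) x)) ([]=⇒lookup x∈)
... | just b | _ = b , refl

∈-varsᵃ-cong : ∀ (p q : Assignment n) {x} → p x ≡ q x → x ∈ varsᵃ p → x ∈ varsᵃ q
∈-varsᵃ-cong p q eq x∈ = ∈-varsᵃ⁺ q (trans (sym eq) (proj₂ (∈-varsᵃ⁻ p x∈)))

just≢just-not : ∀ {b : Bool} → just b ≢ just (not b)
just≢just-not eq = Bool.not-¬ refl (just-injective eq)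

-- Falsified clauses, repairability and scoped redundancy.

satisfied-or-falsifiedᶜ : ∀ (p : Assignment n) C → varsᶜ C ⊆ varsᵃ p →
                          Satisfiesᶜ p C ⊎ Falsifiesᶜ p C
satisfied-or-falsifiedᶜ p C assigned with satisfiesᶜ? p C
... | yes sat  = inj₁ sat
... | no  ¬sat = inj₂ (All.tabulate falsified)
  where
  falsified : ∀ {l} → l List.∈ C → Falsifiesˡ p l
  falsified {x , b} l∈C =
    let c , px≡c = ∈-varsᵃ⁻ p (assigned (∈-varsᶜ⁺ l∈C))
        c≢b c≡b  = ¬sat (List.lose l∈C (trans px≡c (cong just c≡b)))
    in  trans px≡c (cong just (Bool.¬-not c≢b))

FalsifiedContain-mono : ∀ {F : CNF n} {p V Z} → V ⊆ Z →
                        FalsifiedContain F p V → FalsifiedContain F p Z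
FalsifiedContain-mono V⊆Z contain {C} C∈F fal =
  let x , x∈ = contain C∈F fal
      x∈C , x∈V = x∈p∩q⁻ (varsᶜ C) _ x∈
  in  x , x∈p∩q⁺ (x∈C , V⊆Z x∈V)

falsifiedContain? : ∀ (F : CNF n) p → Decidable (FalsifiedContain F p)
falsifiedContain? F p V =
  map′ (λ a {_} → All.lookup a) (λ contain → All.tabulate contain)
       (all? (λ C → all? (falsifiesˡ? p) C →-dec containsVarOf? V C) F)

-- Boundary points without the set `V` and its minimality, so that only `FalsifiedContain` has to be
-- transported between formulas and assignments.
Repairable : CNF n → Subset n → Subset n → Set
Repairable F W Z =
  ∀ p → IsPoint F p → FalsifiedContain F p Z → SatisfiableByChanging W F p

RedundantWithScope⇒Repairable : ∀ {X : Subset n} {F W Z} →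
  RedundantWithScope X F W Z → Repairable F W Z
RedundantWithScope⇒Repairable {F = F} rws p point contain
  with any? (all? (falsifiesˡ? p)) F
-- A point decides every clause, so with none falsified `p` already satisfies `F`.
... | no ¬fal = p , refl , (λ _ → refl) , All.tabulate λ {C} C∈F →
  [ id , (λ fal → contradiction (List.lose C∈F fal) ¬fal) ]′
    (satisfied-or-falsifiedᶜ p C (point ∘ ∈-varsᶠ⁺ C∈F))
... | yes fal =
  let V , V⊆Z , containV , minimal = minimal-subset (falsifiedContain? F p) contain
      -- A falsified clause must contain a variable of `V`, which makes `V` non-empty.
      C , C∈F , falC = List.find fal
      x , x∈C∩V = containV C∈F falC
      V≠∅ = x , proj₂ (x∈p∩q⁻ (varsᶜ C) V x∈C∩V)
  in  RedundantWithScope.scope rws V≠∅ V⊆Z p record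
        { point = point ; nonempty = V≠∅ ; falsifies = fal
        ; contain = containV ; minimal = minimal }

-- An assignment satisfying `F ∖^ Z` can falsify only clauses of `F` that meet `Z`, so it can be
-- repaired; since `W ⊆ X`, the repair keeps the values of the free variables.
Repairable⇒RedundantWithScope : ∀ {X : Subset n} {F W Z} → W ⊆ X →
  Repairable F W Z → RedundantWithScope X F W Z
Repairable⇒RedundantWithScope {X = X} {F} {W} {Z} W⊆X repair = record
  { redundant = λ s assigned → mk⇔ weaken (strengthen s assigned)
  ; scope     = λ _ V⊆Z p bp → repair p (IsBoundaryPoint.point bp)
                  (FalsifiedContain-mono {F = F} V⊆Z (IsBoundaryPoint.contain bp))
  }
  where
  weaken : ∀ {s} → True∃ X F s → True∃ X (F ∖^ Z) s
  weaken (p , X⊆p , p≡s , sat) = p , X⊆p , p≡s ,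
    All.tabulate (All.lookup sat ∘ proj₁ ∘ ∈-filter⁻ (¬? ∘ containsVarOf? Z))

  strengthen : ∀ s → (varsᶠ F ∪ varsᶠ (F ∖^ Z)) ─ X ⊆ varsᵃ s →
               True∃ X (F ∖^ Z) s → True∃ X F s
  strengthen s assigned (p , X⊆p , p≡s , sat) =
    let p* , vars≡ , p*≡p , sat* = repair p point contain
    in  p* , subst (X ⊆_) (sym vars≡) X⊆p ,
        (λ x∉X → trans (p*≡p (x∉X ∘ W⊆X)) (p≡s x∉X)) , sat*
    where
    point : IsPoint F p
    point {x} x∈F with x ∈? X
    ... | yes x∈X = X⊆p x∈X
    ... | no  x∉X = ∈-varsᵃ-cong s p (sym (p≡s x∉X))
                      (assigned (x∈p∧x∉q⇒x∈p─q (x∈p∪q⁺ (inj₁ x∈F)) x∉X))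

    contain : FalsifiedContain F p Z
    contain {C} C∈F fal with containsVarOf? Z C
    ... | yes C∩Z = C∩Z
    ... | no ¬C∩Z =
      let satC = All.lookup sat (∈-filter⁺ (¬? ∘ containsVarOf? Z) C∈F ¬C∩Z)
          l , l∈C , satl = List.find satC
      in  contradiction (trans (sym satl) (All.lookup fal l∈C)) just≢just-not

-- Restriction by an assignment and its extensions.

infixl 8 _∣ᶜ_

_∣ᶜ_ : Clause n → Assignment n → Clause n
C ∣ᶜ q = filter (¬? ∘ falsifiesˡ? q) C

∈-∣ᶜ⁺ : ∀ (q : Assignment n) {C l} → l List.∈ C → ¬ Falsifiesˡ q l → l List.∈ C ∣ᶜ q
∈-∣ᶜ⁺ q = ∈-filter⁺ (¬? ∘ falsifiesˡ? q)

∈-∣ᶜ⁻ : ∀ (q : Assignment n) {C l} → l List.∈ C ∣ᶜ q → l List.∈ C × ¬ Falsifiesˡ q l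
∈-∣ᶜ⁻ q = ∈-filter⁻ (¬? ∘ falsifiesˡ? q)

∈-∣ᵣ⁺ : ∀ {F : CNF n} q {C} → C List.∈ F → ¬ Satisfiesᶜ q C → C ∣ᶜ q List.∈ F ∣ᵣ q
∈-∣ᵣ⁺ q C∈F ¬sat = ∈-map∘filter⁺ (_∣ᶜ q) (¬? ∘ satisfiesᶜ? q) (_ , C∈F , refl , ¬sat)

∈-∣ᵣ⁻ : ∀ {F : CNF n} q {D} → D List.∈ F ∣ᵣ q →
        ∃[ C ] C List.∈ F × D ≡ C ∣ᶜ q × ¬ Satisfiesᶜ q C
∈-∣ᵣ⁻ q = ∈-map∘filter⁻ (_∣ᶜ q) (¬? ∘ satisfiesᶜ? q)

-- A value of `q` at `x` would either satisfy the literal, removing its clause, or falsify it,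
-- deleting the literal.
∈-varsᶠ-∣ᵣ : ∀ (F : CNF n) q {x} → x ∈ varsᶠ (F ∣ᵣ q) → q x ≡ nothing
∈-varsᶠ-∣ᵣ F q {x} x∈ with ∈-varsᶠ⁻ (F ∣ᵣ q) x∈
... | _ , D∈ , x∈D with ∈-∣ᵣ⁻ {F = F} q D∈
... | C , _ , refl , ¬sat with ∈-varsᶜ⁻ (C ∣ᶜ q) x∈D
... | b , l∈D with ∈-∣ᶜ⁻ q l∈D
... | l∈C , ¬fal with q x in eq
... | nothing = refl
... | just c with c Bool.≟ b
... | yes refl = contradiction (List.lose l∈C eq) ¬sat
... | no  c≢b  = contradiction (cong just (Bool.¬-not c≢b)) ¬fal

infix 4 _⊑_

_⊑_ : Assignment n → Assignment n → Set
q ⊑ t = ∀ x {b} → q x ≡ just b → t x ≡ just b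

⊑⇒¬Falsifiesˡ : ∀ {q t : Assignment n} {l} → q ⊑ t → Satisfiesˡ t l → ¬ Falsifiesˡ q l
⊑⇒¬Falsifiesˡ q⊑t sat fal = just≢just-not (trans (sym sat) (q⊑t _ fal))

Satisfies-∣ᵣ⁺ : ∀ {F : CNF n} {q t} → q ⊑ t → Satisfies t F → Satisfies t (F ∣ᵣ q)
Satisfies-∣ᵣ⁺ {F = F} {q} {t} q⊑t sat = All.tabulate satD
  where
  satD : ∀ {D} → D List.∈ F ∣ᵣ q → Satisfiesᶜ t D
  satD D∈ with ∈-∣ᵣ⁻ {F = F} q D∈
  ... | C , C∈F , refl , _ =
    let l , l∈C , satl = List.find (All.lookup sat C∈F)
    in  List.lose (∈-∣ᶜ⁺ q l∈C (⊑⇒¬Falsifiesˡ q⊑t satl)) satl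

-- The clauses that restriction removes are satisfied by `q`, hence by its extension `t`.
Satisfies-∣ᵣ⁻ : ∀ {F : CNF n} {q t} → q ⊑ t → Satisfies t (F ∣ᵣ q) → Satisfies t F
Satisfies-∣ᵣ⁻ {F = F} {q} {t} q⊑t sat = All.tabulate satC
  where
  satC : ∀ {C} → C List.∈ F → Satisfiesᶜ t C
  satC {C} C∈F with satisfiesᶜ? q C
  ... | yes satq = let l , l∈C , satl = List.find satq in List.lose l∈C (q⊑t _ satl)
  ... | no ¬satq =
    let l , l∈D , satl = List.find (All.lookup sat (∈-∣ᵣ⁺ q C∈F ¬satq))
    in  List.lose (proj₁ (∈-∣ᶜ⁻ q l∈D)) satl

Falsifiesᶜ-∣ᶜ⁺ : ∀ {C : Clause n} {q t} → Falsifiesᶜ t C → Falsifiesᶜ t (C ∣ᶜ q)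
Falsifiesᶜ-∣ᶜ⁺ {q = q} fal = All.tabulate (All.lookup fal ∘ proj₁ ∘ ∈-∣ᶜ⁻ q)

-- The deleted literals are falsified by `q`, hence by `t`.
Falsifiesᶜ-∣ᶜ⁻ : ∀ {C : Clause n} {q t} → q ⊑ t → Falsifiesᶜ t (C ∣ᶜ q) → Falsifiesᶜ t C
Falsifiesᶜ-∣ᶜ⁻ {C = C} {q} {t} q⊑t fal = All.tabulate falˡ
  where
  falˡ : ∀ {l} → l List.∈ C → Falsifiesˡ t l
  falˡ {l} l∈C with falsifiesˡ? q l
  ... | yes falq = q⊑t _ falq
  ... | no ¬falq = All.lookup fal (∈-∣ᶜ⁺ q l∈C ¬falq)

⊑⇒¬Satisfiesᶜ : ∀ {C : Clause n} {q t} → q ⊑ t → Falsifiesᶜ t C → ¬ Satisfiesᶜ q C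
⊑⇒¬Satisfiesᶜ q⊑t fal sat =
  let l , l∈C , satl = List.find sat
  in  just≢just-not (trans (sym (q⊑t _ satl)) (All.lookup fal l∈C))

ContainsVarOf-∣ᶜ⁻ : ∀ {Z : Subset n} q C → ContainsVarOf Z (C ∣ᶜ q) → ContainsVarOf Z C
ContainsVarOf-∣ᶜ⁻ {Z = Z} q C (x , x∈) =
  let x∈D , x∈Z = x∈p∩q⁻ (varsᶜ (C ∣ᶜ q)) Z x∈
      b , l∈D   = ∈-varsᶜ⁻ (C ∣ᶜ q) x∈D
  in  x , x∈p∩q⁺ (∈-varsᶜ⁺ {C = C} (proj₁ (∈-∣ᶜ⁻ q l∈D)) , x∈Z)

-- Only literals of variables assigned by `q` are deleted, and `Z` has none of these.
ContainsVarOf-∣ᶜ⁺ : ∀ {Z : Subset n} q C → (∀ {x} → x ∈ Z → x ∉ varsᵃ q) →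
                    ContainsVarOf Z C → ContainsVarOf Z (C ∣ᶜ q)
ContainsVarOf-∣ᶜ⁺ {Z = Z} q C Z∌q (x , x∈) =
  let x∈C , x∈Z = x∈p∩q⁻ (varsᶜ C) Z x∈
      b , l∈C   = ∈-varsᶜ⁻ C x∈C
  in  x , x∈p∩q⁺ (∈-varsᶜ⁺ (∈-∣ᶜ⁺ q l∈C (Z∌q x∈Z ∘ ∈-varsᵃ⁺ q)) , x∈Z)

-- A clause falsified by `t` is not satisfied by `q`, so a part of it survives in `F ∣ᵣ q`, still
-- falsified.
FalsifiedContain-∣ᵣ⁻ : ∀ {F : CNF n} {q t Z} → q ⊑ t →
  FalsifiedContain (F ∣ᵣ q) t Z → FalsifiedContain F t Z
FalsifiedContain-∣ᵣ⁻ {q = q} q⊑t contain {C} C∈F fal =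
  ContainsVarOf-∣ᶜ⁻ q C
    (contain (∈-∣ᵣ⁺ q C∈F (⊑⇒¬Satisfiesᶜ q⊑t fal)) (Falsifiesᶜ-∣ᶜ⁺ {q = q} fal))

FalsifiedContain-∣ᵣ⁺ : ∀ {F : CNF n} {q t Z} → q ⊑ t →
  (∀ {x} → x ∈ Z → x ∉ varsᵃ q) →
  FalsifiedContain F t Z → FalsifiedContain (F ∣ᵣ q) t Z
FalsifiedContain-∣ᵣ⁺ {F = F} {q} q⊑t Z∌q contain D∈ fal with ∈-∣ᵣ⁻ {F = F} q D∈
... | C , C∈F , refl , _ =
  ContainsVarOf-∣ᶜ⁺ q C Z∌q (contain C∈F (Falsifiesᶜ-∣ᶜ⁻ q⊑t fal))

-- Transfer of repairs between assignments and between restrictions.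

AgreeOn : Subset n → Assignment n → Assignment n → Set
AgreeOn U p t = ∀ {x} → x ∈ U → p x ≡ t x

FalsifiedContain-cong : ∀ {F : CNF n} {p t Z} → AgreeOn (varsᶠ F) p t →
  FalsifiedContain F p Z → FalsifiedContain F t Z
FalsifiedContain-cong p≡t contain C∈F fal = contain C∈F
  (All.tabulate λ l∈C → trans (p≡t (∈-varsᶠ⁺ C∈F (∈-varsᶜ⁺ l∈C))) (All.lookup fal l∈C))

Satisfies-cong : ∀ {F : CNF n} {p t} → AgreeOn (varsᶠ F) p t →
  Satisfies t F → Satisfies p F
Satisfies-cong p≡t sat = All.tabulate λ C∈F →
  let l , l∈C , satl = List.find (All.lookup sat C∈F)
  in  List.lose l∈C (trans (p≡t (∈-varsᶠ⁺ C∈F (∈-varsᶜ⁺ l∈C))) satl)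

-- Used to bring a repair of `t` back to `p`: outside `U` the values of `p` must stay, because a
-- repair keeps the set of assigned variables.
patch : Subset n → Assignment n → Assignment n → Assignment n
patch U t p x with x ∈? U
... | yes _ = t x
... | no  _ = p x

patch-∈ : ∀ {U : Subset n} t p → AgreeOn U (patch U t p) t
patch-∈ {U = U} t p {x} x∈U with x ∈? U
... | yes _  = refl
... | no x∉U = contradiction x∈U x∉U

patch-elim : ∀ {U : Subset n} {t p x} → (x ∈ U → t x ≡ p x) → patch U t p x ≡ p x
patch-elim {U = U} {x = x} t≡p with x ∈? U
... | yes x∈U = t≡p x∈U
... | no _    = refl

varsᵃ-patch : ∀ {U : Subset n} {t p} → U ⊆ varsᵃ t → U ⊆ varsᵃ p →
              varsᵃ (patch U t p) ≡ varsᵃ p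
varsᵃ-patch {U = U} {t} {p} U⊆t U⊆p = ⊆-antisym to from
  where
  patch-∉ : ∀ {x} → x ∉ U → patch U t p x ≡ p x
  patch-∉ x∉U = patch-elim (λ x∈U → contradiction x∈U x∉U)

  to : varsᵃ (patch U t p) ⊆ varsᵃ p
  to {x} x∈ with x ∈? U
  ... | yes x∈U = U⊆p x∈U
  ... | no  x∉U = ∈-varsᵃ-cong (patch U t p) p (patch-∉ x∉U) x∈

  from : varsᵃ p ⊆ varsᵃ (patch U t p)
  from {x} x∈ with x ∈? U
  ... | yes x∈U = ∈-varsᵃ-cong t (patch U t p) (sym (patch-∈ t p x∈U)) (U⊆t x∈U)
  ... | no  x∉U = ∈-varsᵃ-cong p (patch U t p) (sym (patch-∉ x∉U)) x∈

SatisfiableByChanging-cong : ∀ {F : CNF n} {W p t} → IsPoint F p →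
  AgreeOn (varsᶠ F) p t → SatisfiableByChanging W F t → SatisfiableByChanging W F p
SatisfiableByChanging-cong {F = F} {p = p} {t} point p≡t (t* , vars≡ , t*≡t , sat) =
  patch (varsᶠ F) t* p ,
  varsᵃ-patch (λ x∈F → subst (_ ∈_) (sym vars≡) (∈-varsᵃ-cong p t (p≡t x∈F) (point x∈F)))
              point ,
  (λ x∉W → patch-elim λ x∈F → trans (t*≡t x∉W) (sym (p≡t x∈F))) ,
  Satisfies-cong (patch-∈ t* p) sat

SatisfiableByChanging-mono : ∀ {F : CNF n} {V W p} → V ⊆ W →
  SatisfiableByChanging V F p → SatisfiableByChanging W F p
SatisfiableByChanging-mono V⊆W (p* , vars≡ , p*≡p , sat) =
  p* , vars≡ , (λ x∉W → p*≡p (x∉W ∘ V⊆W)) , sat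

-- As `t` extends both `q` and `r`, falsified clauses can be compared through `F` itself. Changes in
-- `W` touch neither `q` nor `r`, so the repaired `t*` extends both, and satisfaction passes from
-- `F ∣ᵣ r` to `F` and on to `F ∣ᵣ q`.
repair-∣ᵣ : ∀ {F : CNF n} {q r W Z} → Repairable (F ∣ᵣ r) W Z → Z ⊆ W →
  (∀ {x} → x ∈ W → x ∉ varsᵃ q) → (∀ {x} → x ∈ W → x ∉ varsᵃ r) →
  ∀ t → IsPoint (F ∣ᵣ r) t → q ⊑ t → r ⊑ t →
  FalsifiedContain (F ∣ᵣ q) t Z → SatisfiableByChanging W (F ∣ᵣ q) t
repair-∣ᵣ {F = F} {q} {r} repair Z⊆W W∌q W∌r t point q⊑t r⊑t contain =
  let t* , vars≡ , t*≡t , sat = repair t point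
        (FalsifiedContain-∣ᵣ⁺ {F = F} r⊑t (W∌r ∘ Z⊆W) (FalsifiedContain-∣ᵣ⁻ {F = F} q⊑t contain))
      q⊑t* : q ⊑ t*
      q⊑t* = λ x eq → trans (t*≡t (λ x∈W → W∌q x∈W (∈-varsᵃ⁺ q eq))) (q⊑t x eq)
      r⊑t* : r ⊑ t*
      r⊑t* = λ x eq → trans (t*≡t (λ x∈W → W∌r x∈W (∈-varsᵃ⁺ r eq))) (r⊑t x eq)
  in  t* , vars≡ , t*≡t , Satisfies-∣ᵣ⁺ q⊑t* (Satisfies-∣ᵣ⁻ {F = F} r⊑t* sat)

-- Here `q` overrides `p`, so the result extends `q` even where the two conflict. It is total
-- because a point of `F ∣ᵣ q` may leave variables of another restriction unassigned; the default
-- `true` is arbitrary.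
completion : Assignment n → Assignment n → Assignment n
completion q p x = just (fromMaybe true (q x <∣> p x))

⊑-completion : ∀ (q p : Assignment n) → q ⊑ completion q p
⊑-completion q p x eq rewrite eq = refl

completion-agrees : ∀ {q p : Assignment n} {x} → q x ≡ nothing → x ∈ varsᵃ p →
                    p x ≡ completion q p x
completion-agrees {p = p} eq x∈p with ∈-varsᵃ⁻ p x∈p
... | b , px≡b rewrite eq | px≡b = refl

-- Resolvents of assignments.

module _ {v : Fin n} {q′ q″ : Assignment n} (res : Resolvable q′ q″ v) where

  resolventˡ : ∀ {x b} → x ≢ v → q′ x ≡ just b → resolvent v q′ q″ x ≡ just b
  resolventˡ {x} x≢v eq with x Fin.≟ v
  ... | yes x≡v = contradiction x≡v x≢v
  ... | no  _ rewrite eq = refl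

  resolventʳ : ∀ {x b} → x ≢ v → q″ x ≡ just b → resolvent v q′ q″ x ≡ just b
  resolventʳ {x} {b} x≢v eq″ with x Fin.≟ v
  ... | yes x≡v = contradiction x≡v x≢v
  ... | no  _ with q′ x in eq′
  ... | nothing = eq″
  -- The resolvent prefers `q′`, but a disagreement here would be a conflict away from `v`.
  ... | just a with a Bool.≟ b
  ... | yes refl = refl
  ... | no a≢b = contradiction (proj₂ res (x∈p∩q⁺ (∈-varsᵃ⁺ q′ eq′ , ∈-varsᵃ⁺ q″ eq″) ,
      λ q′≡q″ → a≢b (just-injective (trans (sym eq′) (trans q′≡q″ eq″))))) x≢v

  varsᵃ-resolvent : ∀ {x} → x ∈ varsᵃ (resolvent v q′ q″) → x ∈ varsᵃ q′ ⊎ x ∈ varsᵃ q″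
  varsᵃ-resolvent {x} x∈ with ∈-varsᵃ⁻ (resolvent v q′ q″) x∈
  ... | b , eq with x Fin.≟ v
  ... | no _ with q′ x in eq′
  ... | just _  = inj₁ (∈-varsᵃ⁺ q′ eq′)
  ... | nothing = inj₂ (∈-varsᵃ⁺ q″ eq)

  ⊑-at-v : ∀ {q t : Assignment n} → (∀ {x b} → x ≢ v → q x ≡ just b → t x ≡ just b) →
           q v ≡ t v → q ⊑ t
  ⊑-at-v off-v at-v x eq with x Fin.≟ v
  ... | yes refl = trans (sym at-v) eq
  ... | no  x≢v  = off-v x≢v eq

  -- Away from `v` the resolvent contains both assignments; at `v` they take opposite values, one of
  -- which is that of `t`.
  resolvent-dichotomy : ∀ {t} → v ∈ varsᵃ t → resolvent v q′ q″ ⊑ t → q′ ⊑ t ⊎ q″ ⊑ t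
  resolvent-dichotomy {t} v∈t q⊑t
    with v∈q′ , v∈q″ ← x∈p∩q⁻ (varsᵃ q′) (varsᵃ q″) (proj₁ (proj₁ res))
    with a , eq′ ← ∈-varsᵃ⁻ q′ v∈q′ | b , eq″ ← ∈-varsᵃ⁻ q″ v∈q″ | c , eq ← ∈-varsᵃ⁻ t v∈t
    with a Bool.≟ c
  ... | yes refl = inj₁ (⊑-at-v (λ x≢v → q⊑t _ ∘ resolventˡ x≢v) (trans eq′ (sym eq)))
  ... | no  a≢c  = inj₂ (⊑-at-v (λ x≢v → q⊑t _ ∘ resolventʳ x≢v)
                     (trans eq″ (trans (cong just b≡c) (sym eq))))
    where
    b≢a : b ≢ a
    b≢a b≡a = proj₂ (proj₁ res) (trans eq′ (trans (cong just (sym b≡a)) (sym eq″)))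
    -- Both Booleans differ from `a`, so both equal `not a`.
    b≡c : b ≡ c
    b≡c = trans (Bool.¬-not b≢a) (sym (Bool.¬-not (a≢c ∘ sym)))

-- The D-sequent for the resolvent.

─-disjoint : ∀ {p q : Subset n} {x} → x ∈ p ─ q → x ∉ q
─-disjoint {p = _ ∷ p} {inside ∷ q} () here
─-disjoint {p = _ ∷ p} {_      ∷ q} (there x∈) (there x∈q) = ─-disjoint {p = p} x∈ x∈q

proposition9 : ∀ {n : ℕ} (X : Subset n) (F : CNF n) → X ⊆ varsᶠ F →
    ∀ (q′ q″ : Assignment n) (W′ W″ Z : Subset n) →
    DSequent X F q′ W′ Z →
    DSequent X F q″ W″ Z →
    Empty (varsᵃ q′ ∩ W″) →
    Empty (varsᵃ q″ ∩ W′) →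
    ∀ (v : Fin n) → v ∈ varsᶠ F →
    Resolvable q′ q″ v →
    DSequent X F (resolvent v q′ q″) (W′ ∪ W″) Z
proposition9 {n} X F _ q′ q″ W′ W″ Z D′ D″ q′∩W″=∅ q″∩W′=∅ v _ res = record
  { vars-q = [ D′.vars-q , D″.vars-q ]′ ∘ varsᵃ-resolvent res
  ; Z⊆W    = p⊆p∪q W″ ∘ D′.Z⊆W
  ; W⊆X─q  = λ x∈W → x∈p∧x∉q⇒x∈p─q (W⊆X x∈W) (W∌q x∈W)
  ; holds  = Repairable⇒RedundantWithScope W⊆X repair
  }
  where
  module D′ = DSequent D′
  module D″ = DSequent D″

  q : Assignment n
  q = resolvent v q′ q″

  W⊆X : W′ ∪ W″ ⊆ X
  W⊆X = [ p─q⊆p X _ ∘ D′.W⊆X─q , p─q⊆p X _ ∘ D″.W⊆X─q ]′ ∘ x∈p∪q⁻ W′ W″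

  W′∌q′ : ∀ {x} → x ∈ W′ → x ∉ varsᵃ q′
  W′∌q′ = ─-disjoint {p = X} ∘ D′.W⊆X─q

  W″∌q″ : ∀ {x} → x ∈ W″ → x ∉ varsᵃ q″
  W″∌q″ = ─-disjoint {p = X} ∘ D″.W⊆X─q

  -- Well-formedness of the first D-sequent keeps `W′` off `q′`, and the disjointness hypothesis
  -- keeps it off `q″`.
  W′∌q : ∀ {x} → x ∈ W′ → x ∉ varsᵃ q
  W′∌q x∈W′ x∈q = [ W′∌q′ x∈W′ , (λ x∈q″ → q″∩W′=∅ (_ , x∈p∩q⁺ (x∈q″ , x∈W′))) ]′
    (varsᵃ-resolvent res x∈q)

  W″∌q : ∀ {x} → x ∈ W″ → x ∉ varsᵃ q
  W″∌q x∈W″ x∈q = [ (λ x∈q′ → q′∩W″=∅ (_ , x∈p∩q⁺ (x∈q′ , x∈W″))) , W″∌q″ x∈W″ ]′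
    (varsᵃ-resolvent res x∈q)

  W∌q : ∀ {x} → x ∈ W′ ∪ W″ → x ∉ varsᵃ q
  W∌q = [ W′∌q , W″∌q ]′ ∘ x∈p∪q⁻ W′ W″

  repair : Repairable (F ∣ᵣ q) (W′ ∪ W″) Z
  repair p point contain = SatisfiableByChanging-cong {F = F ∣ᵣ q} point p≡t repair-t
    where
    t : Assignment n
    t = completion q p

    total : ∀ x → x ∈ varsᵃ t
    total x = ∈-varsᵃ⁺ t refl

    q⊑t : q ⊑ t
    q⊑t = ⊑-completion q p

    -- Overwriting by `q` changes no variable of `F ∣ᵣ q`, since `q` assigns none of them.
    p≡t : AgreeOn (varsᶠ (F ∣ᵣ q)) p t
    p≡t x∈ = completion-agrees {q = q} (∈-varsᶠ-∣ᵣ F q x∈) (point x∈)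

    contain-t : FalsifiedContain (F ∣ᵣ q) t Z
    contain-t = FalsifiedContain-cong {F = F ∣ᵣ q} p≡t contain

    repair-t : SatisfiableByChanging (W′ ∪ W″) (F ∣ᵣ q) t
    -- The value of `t` at `v` selects which of the two given D-sequents supplies the repair.
    repair-t with resolvent-dichotomy res (total v) q⊑t
    ... | inj₁ q′⊑t = SatisfiableByChanging-mono {F = F ∣ᵣ q} (p⊆p∪q W″)
      (repair-∣ᵣ {F = F} (RedundantWithScope⇒Repairable D′.holds) D′.Z⊆W
        W′∌q W′∌q′ t (λ {x} _ → total x) q⊑t q′⊑t contain-t)
    ... | inj₂ q″⊑t = SatisfiableByChanging-mono {F = F ∣ᵣ q} (q⊆p∪q W′ W″)
      (repair-∣ᵣ {F = F} (RedundantWithScope⇒Repairable D″.holds) D″.Z⊆W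
        W″∌q W″∌q″ t (λ {x} _ → total x) q⊑t q″⊑t contain-t)
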